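{- Let $G$ be a graph (finite, simple, without isolated vertices). Then $G$ admits a topological integer additive set-labeling if and only if $G$ has at least one pendant vertex.
   Context: For sets $A,B$ of non-negative integers, $A+B=\{a+b: a\in A, b\in B\}$. For a non-empty finite set $X$ of non-negative integers, a topological integer additive set-labeling (TIASL) of a graph $G$ with respect to the ground set $X$ is an injective function $f:V(G)\to\mathcal{P}(X)\setminus\{\emptyset\}$ such that $f(u)+f(v)\subseteq X$ for every edge $uv\in E(G)$ and $f(V(G))\cup\{\emptyset\}$ is a topology on $X$. A graph $G$ admits a TIASL if there exist some non-empty finite set $X$ of non-negative integers and a TIASL of $G$ with respect to $X$. A pendant vertex is a vertex of degree $1$. -}

module Defs where

open import Data.Fin.Base using (Fin)
open import Data.List.Base using (List; []; length; filter; allFin; cartesianProductWith)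
open import Data.List.Membership.Propositional using (_∈_)
open import Data.List.Membership.DecPropositional using (_∈?_)
open import Data.List.Relation.Binary.BagAndSetEquality using (_∼[_]_; set)
open import Data.List.Relation.Binary.Subset.Propositional using (_⊆_)
open import Data.Nat.Base using (ℕ; _+_)
open import Data.Nat.Properties using (_≟_)
open import Data.Product.Base using (∃; _×_)
open import Data.Sum.Base using (_⊎_)
open import Function.Bundles using (_⇔_)
open import Function.Definitions using (Injective)
open import Level using (0ℓ; suc)
open import Relation.Binary.Core using (Rel)
open import Relation.Binary.Definitions using (Symmetric; Irreflexive; Decidable)
open import Relation.Binary.PropositionalEquality.Core using (_≡_)
open import Relation.Nullary.Negation.Core using (¬_)
open import Relation.Unary using (Pred)

-- A finite set of non-negative integers is given by a list of its elements.
-- Order and multiplicity carry no meaning: equality of sets is always _≋_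
-- (same elements), never propositional equality of lists.
FinSet : Set
FinSet = List ℕ

infix 4 _≋_

_≋_ : Rel FinSet 0ℓ
A ≋ B = A ∼[ set ] B

∅ : FinSet
∅ = []

NonEmpty : Pred FinSet 0ℓ
NonEmpty A = ¬ (A ≋ ∅)

infixl 7 _∩_
infixl 6 _⊕_

_∩_ : FinSet → FinSet → FinSet
A ∩ B = filter (λ x → _∈?_ _≟_ x B) A

_⊕_ : FinSet → FinSet → FinSet
A ⊕ B = cartesianProductWith _+_ A B

IsUnionOf : FinSet → Pred FinSet 0ℓ → Set
IsUnionOf U 𝒮 = ∀ x → x ∈ U ⇔ ∃ λ S → 𝒮 S × x ∈ S

-- Closure under unions ranges over arbitrary subfamilies 𝒮 of τ. The union U
-- is specified by its elements rather than computed from 𝒮: 𝒮 need not be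
-- decidable, so its union cannot in general be computed as a list.
-- Classically every subset of X is a FinSet, so this is no restriction.
record IsTopology (X : FinSet) (τ : Pred FinSet 0ℓ) : Set (suc 0ℓ) where
  field
    subsets       : ∀ A → τ A → A ⊆ X
    ∅-open        : τ ∅
    whole-open    : τ X
    ⋃-closed      : ∀ (𝒮 : Pred FinSet 0ℓ) (U : FinSet) →
                    (∀ S → 𝒮 S → τ S) → IsUnionOf U 𝒮 → τ U
    ∩-closed      : ∀ A B → τ A → τ B → τ (A ∩ B)

record Graph : Set (suc 0ℓ) where
  field
    order  : ℕ
    Adj    : Rel (Fin order) 0ℓ
    sym    : Symmetric Adj
    irrefl : Irreflexive _≡_ Adj
    adj?   : Decidable Adj

  Vertex : Set
  Vertex = Fin order

  degree : Vertex → ℕ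
  degree v = length (filter (adj? v) (allFin order))

  Isolated : Pred Vertex 0ℓ
  Isolated v = degree v ≡ 0

  Pendant : Pred Vertex 0ℓ
  Pendant v = degree v ≡ 1

module _ (G : Graph) where
  open Graph G

  -- f(V(G)) ∪ {∅}, as a family of sets closed under _≋_.
  image∪∅ : (Vertex → FinSet) → Pred FinSet 0ℓ
  image∪∅ f A = (∃ λ v → A ≋ f v) ⊎ A ≋ ∅

  record IsTIASL (X : FinSet) (f : Vertex → FinSet) : Set (suc 0ℓ) where
    field
      subset    : ∀ v → f v ⊆ X
      nonEmpty  : ∀ v → NonEmpty (f v)
      injective : Injective _≡_ _≋_ f
      edge-sum  : ∀ u v → Adj u v → f u ⊕ f v ⊆ X
      topology  : IsTopology X (image∪∅ f)

  AdmitsTIASL : Set (suc 0ℓ)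
  AdmitsTIASL = ∃ λ (X : FinSet) → NonEmpty X × ∃ λ (f : Vertex → FinSet) → IsTIASL X f

  NoIsolatedVertices : Set
  NoIsolatedVertices = ∀ v → ¬ Isolated v

  HasPendantVertex : Set
  HasPendantVertex = ∃ λ v → Pendant v

{-# OPTIONS --safe #-}
-- If f is a TIASL, the ground set X is open and non-empty, so X = f v for some v.
-- A neighbour u of v satisfies f u + X ⊆ X, and comparing with the maximum of X
-- gives f u = {0}; by injectivity v has only one neighbour.
--
-- Conversely, let v be pendant with neighbour w. Any family of initial segments
-- of ℕ having X as largest member is, with ∅ added, a topology on X. Label w
-- by {0}, v by a long segment X, and the other vertices by further distinct segments
-- of at most half the length of X, so that their sumsets still lie in X.
module Submission where

open import Defs
open import Data.Empty using (⊥-elim)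
open import Data.Fin.Base using (toℕ)
import Data.Fin.Properties as Fin
open import Data.List.Base using (List; []; _∷_; filter; allFin; upTo)
open import Data.List.Extrema.Nat using (max; argmax-sel; xs≤max; ⊥≤max)
open import Data.List.Membership.DecPropositional using (_∈?_)
open import Data.List.Membership.Propositional using (_∈_)
open import Data.List.Membership.Propositional.Properties
  using (∈-filter⁺; ∈-filter⁻; ∈-allFin; ∈-upTo⁺; ∈-upTo⁻;
         ∈-cartesianProductWith⁺; ∈-cartesianProductWith⁻)
open import Data.List.Relation.Binary.Subset.Propositional using (_⊆_)
import Data.List.Relation.Unary.All as All
open import Data.List.Relation.Unary.AllPairs using (_∷_)
open import Data.List.Relation.Unary.Any using (here; there)
import Data.List.Relation.Unary.Unique.Propositional.Properties as Unique
open import Data.Nat.Base using (ℕ; zero; suc; _+_; _≤_; _<_; z≤n; s≤s)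
open import Data.Nat.Properties
open import Data.Product.Base using (∃; _×_; _,_; proj₁; proj₂)
open import Data.Sum.Base using (inj₁; inj₂)
open import Function.Base using (id)
open import Function.Bundles using (_⇔_; mk⇔; Equivalence)
open import Level using (0ℓ)
open import Relation.Binary.PropositionalEquality
  using (_≡_; _≢_; refl; sym; trans; subst)
open import Relation.Nullary using (¬_; Dec; yes; no)
open import Relation.Unary using (Pred)

open Equivalence using (to; from)

-- Finite sets given by lists, and their maxima.

≋-antisym : ∀ {A B} → A ⊆ B → B ⊆ A → A ≋ B
≋-antisym A⊆B B⊆A = mk⇔ A⊆B B⊆A

nonEmpty⇒∃∈ : ∀ A → NonEmpty A → ∃ λ x → x ∈ A
nonEmpty⇒∃∈ []      A≢∅ = ⊥-elim (A≢∅ (mk⇔ id id))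
nonEmpty⇒∃∈ (x ∷ _) _   = x , here refl

∈⇒nonEmpty : ∀ {A x} → x ∈ A → NonEmpty A
∈⇒nonEmpty x∈A A≋∅ with () ← to A≋∅ x∈A

maximum : ∀ {x} A → x ∈ A → ∃ λ m → m ∈ A × (∀ {y} → y ∈ A → y ≤ m)
maximum (a ∷ A) _ = max a A , max∈ , bound
  where
  max∈ : max a A ∈ a ∷ A
  max∈ with argmax-sel id a A
  ... | inj₁ eq = here eq
  ... | inj₂ m∈ = there m∈
  bound : ∀ {y} → y ∈ a ∷ A → y ≤ max a A
  bound (here refl) = ⊥≤max a A
  bound (there y∈)  = All.lookup (xs≤max a A) y∈

-- For the maximum `m` of `X`, the sum `a + m` again lies in `X`, hence is at most `m`.
⊕-stable⇒0 : ∀ {A X x a} → x ∈ X → A ⊕ X ⊆ X → a ∈ A → a ≡ 0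
⊕-stable⇒0 {X = X} {a = a} x∈X A⊕X⊆X a∈A =
  let m , m∈X , bound = maximum X x∈X
  in n≤0⇒n≡0 (+-cancelʳ-≤ m a 0 (bound (A⊕X⊆X (∈-cartesianProductWith⁺ _+_ a∈A m∈X))))

-- Initial segments of ℕ.

upTo-⊆ : ∀ {m n} → m ≤ n → upTo m ⊆ upTo n
upTo-⊆ m≤n x∈ = ∈-upTo⁺ (<-≤-trans (∈-upTo⁻ x∈) m≤n)

upTo-⊆⁻ : ∀ {m n} → upTo m ⊆ upTo n → m ≤ n
upTo-⊆⁻ {zero}  _   = z≤n
-- `m` is the largest element of `upTo (suc m)`, and `m < n` unfolds to `suc m ≤ n`.
upTo-⊆⁻ {suc m} sub = ∈-upTo⁻ (sub (∈-upTo⁺ ≤-refl))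

upTo-injective : ∀ {m n} → upTo m ≋ upTo n → m ≡ n
upTo-injective eq = ≤-antisym (upTo-⊆⁻ (to eq)) (upTo-⊆⁻ (from eq))

upTo-nonEmpty : ∀ {n} → 0 < n → NonEmpty (upTo n)
upTo-nonEmpty 0<n = ∈⇒nonEmpty (∈-upTo⁺ 0<n)

∩-⊆ : ∀ A B {x} → x ∈ A ∩ B → x ∈ A × x ∈ B
∩-⊆ A B = ∈-filter⁻ (λ x → _∈?_ _≟_ x B) {xs = A}

∩-⊇ : ∀ A B {x} → x ∈ A → x ∈ B → x ∈ A ∩ B
∩-⊇ A B = ∈-filter⁺ (λ x → _∈?_ _≟_ x B)

module _ (G : Graph) where
  open Graph G using (Vertex; Adj; adj?; order; Isolated; Pendant)

  -- Neighbourhoods and pendant vertices.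

  neighbours : Vertex → List Vertex
  neighbours v = filter (adj? v) (allFin order)

  ∈-neighbours⁺ : ∀ {v u} → Adj v u → u ∈ neighbours v
  ∈-neighbours⁺ {v} {u} = ∈-filter⁺ (adj? v) (∈-allFin u)

  ∈-neighbours⁻ : ∀ {v u} → u ∈ neighbours v → Adj v u
  ∈-neighbours⁻ {v} u∈ = proj₂ (∈-filter⁻ (adj? v) {xs = allFin order} u∈)

  pendant⁻ : ∀ {v} → Pendant v → ∃ λ w → Adj v w × (∀ {u} → Adj v u → u ≡ w)
  -- Abstracting the membership facts together with the list restates them for `w ∷ []` once `deg`
  -- is matched.
  pendant⁻ {v} deg with neighbours v | ∈-neighbours⁺ {v} | ∈-neighbours⁻ {v}
  pendant⁻ {v} refl | w ∷ [] | mem⁺ | mem⁻ = w , mem⁻ (here refl) , λ adj → only (mem⁺ adj)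
    where
    only : ∀ {u} → u ∈ w ∷ [] → u ≡ w
    only (here eq) = eq

  pendant⁺ : ∀ {v} → ¬ Isolated v → (∀ {u u′} → Adj v u → Adj v u′ → u ≡ u′) → Pendant v
  pendant⁺ {v} nonIsolated unique
    with neighbours v | ∈-neighbours⁻ {v} | Unique.filter⁺ (adj? v) (Unique.allFin⁺ order)
  ... | []        | _    | _ = ⊥-elim (nonIsolated refl)
  ... | _ ∷ []    | _    | _ = refl
  -- `allFin` lists no vertex twice and filtering preserves this, so two entries are two distinct
  -- neighbours.
  ... | _ ∷ _ ∷ _ | mem⁻ | (a≢b All.∷ _) ∷ _ =
    ⊥-elim (a≢b (unique (mem⁻ (here refl)) (mem⁻ (there (here refl)))))

  -- Necessity: from a labelling to a pendant vertex.

  admits⇒pendant : NoIsolatedVertices G → AdmitsTIASL G → HasPendantVertex G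
  admits⇒pendant noIsolated (X , X≢∅ , f , tiasl) = pendantAt (IsTopology.whole-open topology)
    where
    open IsTIASL tiasl
    pendantAt : image∪∅ G f X → HasPendantVertex G
    pendantAt (inj₂ X≋∅)        = ⊥-elim (X≢∅ X≋∅)
    pendantAt (inj₁ (v , X≋fv)) = v , pendant⁺ (noIsolated v) λ adj adj′ →
      injective (≋-antisym (neighbour-⊆ adj adj′) (neighbour-⊆ adj′ adj))
      where
      neighbour-zero : ∀ {u a} → Adj v u → a ∈ f u → a ≡ 0
      neighbour-zero {u} adj = ⊕-stable⇒0 (proj₂ (nonEmpty⇒∃∈ X X≢∅)) λ x∈ →
        -- `X` and `f v` agree only up to `_≋_`, so each sum is rebuilt with its second summand
        -- moved into `f v`.
        let a , b , a∈ , b∈ , eq = ∈-cartesianProductWith⁻ _+_ (f u) X x∈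
        in edge-sum u v (Graph.sym G adj)
             (subst (_∈ f u ⊕ f v) (sym eq) (∈-cartesianProductWith⁺ _+_ a∈ (to X≋fv b∈)))

      -- All elements of either label are 0, and `f u′` has at least one.
      neighbour-⊆ : ∀ {u u′} → Adj v u → Adj v u′ → f u ⊆ f u′
      neighbour-⊆ {u′ = u′} adj adj′ x∈ =
        let y , y∈ = nonEmpty⇒∃∈ (f u′) (nonEmpty u′)
        in subst (_∈ f u′) (trans (neighbour-zero adj′ y∈) (sym (neighbour-zero adj x∈))) y∈

  -- Sufficiency: labelling by initial segments.

  -- The union of a family of initial segments is the member containing the
  -- maximum of the union, so no decidability of the family is needed.
  segments-topology : ∀ (ρ : Vertex → ℕ) v → (∀ u → ρ u ≤ ρ v) →
                      IsTopology (upTo (ρ v)) (image∪∅ G (λ u → upTo (ρ u)))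
  segments-topology ρ v ρ≤ρv = record
    { subsets    = subsets
    ; ∅-open     = inj₂ (mk⇔ id id)
    ; whole-open = inj₁ (v , mk⇔ id id)
    ; ⋃-closed   = ⋃-closed
    ; ∩-closed   = ∩-closed
    }
    where
    τ : Pred FinSet 0ℓ
    τ = image∪∅ G (λ u → upTo (ρ u))

    subsets : ∀ A → τ A → A ⊆ upTo (ρ v)
    subsets A (inj₁ (u , A≋)) x∈ = upTo-⊆ (ρ≤ρv u) (to A≋ x∈)
    subsets A (inj₂ A≋∅)      x∈ = ⊥-elim (∈⇒nonEmpty x∈ A≋∅)

    ⋃-closed : ∀ (𝒮 : Pred FinSet 0ℓ) (U : FinSet) →
               (∀ S → 𝒮 S → τ S) → IsUnionOf U 𝒮 → τ U
    ⋃-closed 𝒮 []        _   _     = inj₂ (mk⇔ id id)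
    ⋃-closed 𝒮 U@(_ ∷ _) 𝒮⊆τ union with maximum U (here refl)
    ... | m , m∈U , bound with to (union m) m∈U
    ... | S , S∈𝒮 , m∈S with 𝒮⊆τ S S∈𝒮
    ... | inj₂ S≋∅      = ⊥-elim (∈⇒nonEmpty m∈S S≋∅)
    ... | inj₁ (u , S≋) = inj₁ (u , ≋-antisym
      (λ x∈U → ∈-upTo⁺ (≤-<-trans (bound x∈U) (∈-upTo⁻ (to S≋ m∈S))))
      (λ x∈ → from (union _) (S , S∈𝒮 , from S≋ x∈)))

    -- Initial segments are nested, so the intersection of two is the shorter one.
    ∩-closed : ∀ A B → τ A → τ B → τ (A ∩ B)
    ∩-closed A B (inj₂ A≋∅) _ = inj₂ (≋-antisym (λ x∈ → to A≋∅ (proj₁ (∩-⊆ A B x∈))) λ ())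
    ∩-closed A B (inj₁ _) (inj₂ B≋∅) = inj₂ (≋-antisym (λ x∈ → to B≋∅ (proj₂ (∩-⊆ A B x∈))) λ ())
    ∩-closed A B (inj₁ (a , A≋)) (inj₁ (b , B≋)) with ≤-total (ρ a) (ρ b)
    ... | inj₁ a≤b = inj₁ (a , ≋-antisym
      (λ x∈ → to A≋ (proj₁ (∩-⊆ A B x∈)))
      (λ x∈ → ∩-⊇ A B (from A≋ x∈) (from B≋ (upTo-⊆ a≤b x∈))))
    ... | inj₂ b≤a = inj₁ (b , ≋-antisym
      (λ x∈ → to B≋ (proj₂ (∩-⊆ A B x∈)))
      (λ x∈ → ∩-⊇ A B (from A≋ (upTo-⊆ b≤a x∈)) (from B≋ x∈)))

  module Labelling {v w : Vertex} (v-w : Adj v w) (only-w : ∀ {u} → Adj v u → u ≡ w) where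

    -- Twice `suc order`, the bound on all ranks except that of `v`, so that sums along edges
    -- avoiding `v` stay below `N`.
    N : ℕ
    N = suc order + suc order

    -- Recording the case that produced a rank lets later proofs match on it without repeating the
    -- equality tests of `rank`. The offset 2 keeps the remaining ranks clear of the 1 given to `w`.
    data Rank (u : Vertex) : ℕ → Set where
      neighbour : u ≡ w → Rank u 1
      leaf      : u ≡ v → Rank u N
      other     : u ≢ w → u ≢ v → Rank u (2 + toℕ u)

    rank : ∀ u → ∃ (Rank u)
    rank u with u Fin.≟ w | u Fin.≟ v
    ... | yes u≡w | _       = 1 , neighbour u≡w
    ... | no _    | yes u≡v = N , leaf u≡v
    ... | no u≢w  | no u≢v  = 2 + toℕ u , other u≢w u≢v

    ρ : Vertex → ℕ
    ρ u = proj₁ (rank u)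

    v≢w : v ≢ w
    v≢w v≡w = Graph.irrefl G v≡w v-w

    other≤ : ∀ u → 2 + toℕ u ≤ suc order
    other≤ u = s≤s (Fin.toℕ<n u)

    other<N : ∀ u → 2 + toℕ u < N
    other<N u = ≤-<-trans (other≤ u) (m<m+n (suc order) 0<1+n)

    1<N : 1 < N
    1<N = s≤s (m≤n⇒m≤o+n order 0<1+n)

    Rank≤N : ∀ {u k} → Rank u k → k ≤ N
    Rank≤N (neighbour _)   = <⇒≤ 1<N
    Rank≤N (leaf _)        = ≤-refl
    Rank≤N {u} (other _ _) = <⇒≤ (other<N u)

    0<Rank : ∀ {u k} → Rank u k → 0 < k
    0<Rank (neighbour _) = 0<1+n
    0<Rank (leaf _)      = 0<1+n
    0<Rank (other _ _)   = 0<1+n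

    Rank-v : ∀ {k} → Rank v k → k ≡ N
    Rank-v (neighbour v≡w) = ⊥-elim (v≢w v≡w)
    Rank-v (leaf _)        = refl
    Rank-v (other _ v≢v)   = ⊥-elim (v≢v refl)

    Rank-w : ∀ {k} → Rank w k → k ≡ 1
    Rank-w (neighbour _) = refl
    Rank-w (leaf w≡v)    = ⊥-elim (v≢w (sym w≡v))
    Rank-w (other w≢w _) = ⊥-elim (w≢w refl)

    Rank≤1+order : ∀ {u k} → u ≢ v → Rank u k → k ≤ suc order
    Rank≤1+order     u≢v (neighbour _) = s≤s z≤n
    Rank≤1+order     u≢v (leaf u≡v)    = ⊥-elim (u≢v u≡v)
    Rank≤1+order {u} u≢v (other _ _)   = other≤ u

    -- The three kinds of rank take disjoint values: 1, then `N`, then numbers from 2 to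
    -- `suc order`, among which `toℕ` separates the vertices.
    Rank-injective : ∀ {u u′ k k′} → Rank u k → Rank u′ k′ → k ≡ k′ → u ≡ u′
    Rank-injective (neighbour refl) (neighbour refl) _  = refl
    Rank-injective (neighbour _)    (leaf _)         eq = ⊥-elim (<⇒≢ 1<N eq)
    Rank-injective (neighbour _)    (other _ _)      ()
    Rank-injective (leaf _)         (neighbour _)    eq = ⊥-elim (<⇒≢ 1<N (sym eq))
    Rank-injective (leaf refl)      (leaf refl)      _  = refl
    Rank-injective {u′ = u′} (leaf _) (other _ _)    eq = ⊥-elim (<⇒≢ (other<N u′) (sym eq))
    Rank-injective (other _ _)      (neighbour _)    ()
    Rank-injective {u} (other _ _)  (leaf _)         eq = ⊥-elim (<⇒≢ (other<N u) eq)
    Rank-injective (other _ _)      (other _ _)      eq =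
      Fin.toℕ-injective (suc-injective (suc-injective eq))

    ρv≡N : ρ v ≡ N
    ρv≡N = Rank-v (proj₂ (rank v))

    ρ≤ρv : ∀ u → ρ u ≤ ρ v
    ρ≤ρv u = subst (ρ u ≤_) (sym ρv≡N) (Rank≤N (proj₂ (rank u)))

    -- The neighbour `u` must be `w`, whose rank 1 forces `y` to be 0.
    v-sum : ∀ {u x y} → Adj v u → x < ρ v → y < ρ u → x + y < ρ v
    v-sum {x = x} v-u x< y< with refl ← only-w v-u
      with refl ← n<1⇒n≡0 (subst (_ <_) (Rank-w (proj₂ (rank w))) y<) =
      subst (_< ρ v) (sym (+-identityʳ x)) x<

    sum< : ∀ {a b x y} → Adj a b → x < ρ a → y < ρ b → x + y < ρ v
    sum< {a} {b} {x} {y} a-b x< y< = go (a Fin.≟ v) (b Fin.≟ v)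
      where
      go : Dec (a ≡ v) → Dec (b ≡ v) → x + y < ρ v
      go (yes refl) _          = v-sum a-b x< y<
      go (no _)     (yes refl) = subst (_< ρ v) (+-comm y x) (v-sum (Graph.sym G a-b) y< x<)
      -- Away from `v`, each summand is below half of `N`.
      go (no a≢v)   (no b≢v)   = subst (x + y <_) (sym ρv≡N) (+-mono-<
        (<-≤-trans x< (Rank≤1+order a≢v (proj₂ (rank a))))
        (<-≤-trans y< (Rank≤1+order b≢v (proj₂ (rank b)))))

    labelling : IsTIASL G (upTo (ρ v)) (λ u → upTo (ρ u))
    labelling = record
      { subset    = λ u → upTo-⊆ (ρ≤ρv u)
      ; nonEmpty  = λ u → upTo-nonEmpty (0<Rank (proj₂ (rank u)))
      ; injective = λ {u} {u′} eq →
          Rank-injective (proj₂ (rank u)) (proj₂ (rank u′)) (upTo-injective eq)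
      ; edge-sum  = λ a b a-b z∈ →
          let x , y , x∈ , y∈ , eq = ∈-cartesianProductWith⁻ _+_ (upTo (ρ a)) (upTo (ρ b)) z∈
          in subst (_∈ upTo (ρ v)) (sym eq) (∈-upTo⁺ (sum< a-b (∈-upTo⁻ x∈) (∈-upTo⁻ y∈)))
      ; topology  = segments-topology ρ v ρ≤ρv
      }

  pendant⇒admits : HasPendantVertex G → AdmitsTIASL G
  pendant⇒admits (v , pendant) =
    let w , v-w , only-w = pendant⁻ pendant
        open Labelling v-w only-w
    -- The ground set is the label of `v`, so it is non-empty like every label.
    in upTo (ρ v) , IsTIASL.nonEmpty labelling v , (λ u → upTo (ρ u)) , labelling

theorem2p13 : (G : Graph) → NoIsolatedVertices G → AdmitsTIASL G ⇔ HasPendantVertex G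
theorem2p13 G noIsolated = mk⇔ (admits⇒pendant G noIsolated) (pendant⇒admits G)
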